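{- Let $D=(E,\mathcal F)$ be a vf-safe delta-matroid, and let $\sigma\in\{\ast\times,\times\ast\}$. Then there exists a subset $A\subseteq E$, together with an ordering $e_1,\ldots,e_k$ of the elements of $A$, such that $$\omega(D^{\sigma|A})=\max_{B\subseteq E}\omega(D^{\sigma|B}),$$ and the sequence $$\omega(D),\ \omega(D^{\sigma|\{e_1\}}),\ \omega(D^{\sigma|\{e_1,e_2\}}),\ \ldots,\ \omega(D^{\sigma|A})$$ is non-decreasing.
   Context: A set system is a pair $D=(E,\mathcal F)$ with $E$ a finite set and $\mathcal F\subseteq 2^E$; the members of $\mathcal F$ are the feasible sets. $D$ is proper if $\mathcal F\neq\emptyset$. A delta-matroid is a proper set system such that for all $X,Y\in\mathcal F$ and every $u\in X\triangle Y$ there exists $v\in X\triangle Y$ (possibly $v=u$) with $X\triangle\{u,v\}\in\mathcal F$, where $\triangle$ is symmetric difference. For proper $D$, $r(D_{\max})$ and $r(D_{\min})$ denote the largest and smallest cardinality of a feasible set, and the width is $\omega(D)=r(D_{\max})-r(D_{\min})$. Twist: for $A\subseteq E$, $D^{\ast|A}=(E,\{F\triangle A\mid F\in\mathcal F\})$. Loop complementation: for $e\in E$, $D^{\times|e}=(E,\mathcal F')$ with $\mathcal F'=\mathcal F\,\triangle\,\{F\cup\{e\}\mid F\in\mathcal F,\ e\notin F\}$. Loop complementations on distinct elements commute, and for $A\subseteq E$, $D^{\times|A}$ is obtained by applying loop complementation to every element of $A$. These operations preserve properness. Words are read left to right: $D^{\ast\times|A}=(D^{\ast|A})^{\times|A}$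 and $D^{\times\ast|A}=(D^{\times|A})^{\ast|A}$; also $D^{\sigma|\emptyset}=D$. A delta-matroid $D$ is vf-safe if every set system obtained from $D$ by an arbitrary finite sequence of twists and loop complementations (on elements or subsets of $E$) is again a delta-matroid. -}

module Defs where

open import Data.Bool.Base using (Bool; T; _xor_)
open import Data.Bool.Properties using (T?) renaming (_≟_ to _≟ᵇ_)
open import Data.Fin.Base using (Fin)
open import Data.Fin.Subset
  using (Subset; inside; outside; _∈_; _∪_; ⁅_⁆; ⋃; ∣_∣)
open import Data.Fin.Subset.Properties using (_∈?_; anySubset?)
open import Data.List.Base
  using (List; []; _∷_; _++_; map; filter; foldl; allFin)
open import Data.List.Extrema.Nat using (max; min)
open import Data.List.Relation.Unary.Unique.Propositional using (Unique)
open import Data.Nat.Base using (ℕ; zero; suc; _∸_)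
open import Data.Product.Base using (∃-syntax; _×_)
open import Data.Vec.Base using ([]; _∷_; zipWith)
open import Data.Vec.Properties using (≡-dec)
open import Relation.Binary.PropositionalEquality using (_≡_)
open import Relation.Nullary.Decidable using (Dec; does; _×-dec_; ¬?)

private
  variable
    n : ℕ

infixl 6 _△_
_△_ : Subset n → Subset n → Subset n
_△_ = zipWith _xor_

-- The ground set is Fin n; the family of feasible sets is given by its
-- characteristic function.
SetSystem : ℕ → Set
SetSystem n = Subset n → Bool

infix 4 _∈ᶠ_
_∈ᶠ_ : Subset n → SetSystem n → Set
X ∈ᶠ D = T (D X)

_∈ᶠ?_ : (X : Subset n) (D : SetSystem n) → Dec (X ∈ᶠ D)
X ∈ᶠ? D = T? (D X)

_≟ˢ_ : (X Y : Subset n) → Dec (X ≡ Y)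
_≟ˢ_ = ≡-dec _≟ᵇ_

Proper : SetSystem n → Set
Proper D = ∃[ X ] X ∈ᶠ D

record IsDeltaMatroid {n : ℕ} (D : SetSystem n) : Set where
  field
    proper   : Proper D
    exchange : ∀ X Y → X ∈ᶠ D → Y ∈ᶠ D →
               ∀ u → u ∈ X △ Y →
               ∃[ v ] (v ∈ X △ Y × (X △ (⁅ u ⁆ ∪ ⁅ v ⁆)) ∈ᶠ D)

subsets : (n : ℕ) → List (Subset n)
subsets zero    = [] ∷ []
subsets (suc n) = map (outside ∷_) (subsets n) ++ map (inside ∷_) (subsets n)

feasibleSets : SetSystem n → List (Subset n)
feasibleSets {n} D = filter (_∈ᶠ? D) (subsets n)

-- The first arguments of max and min are neutral here, since every
-- cardinality lies between 0 and n; they only give a value for improper D.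
rmax : SetSystem n → ℕ
rmax D = max 0 (map ∣_∣ (feasibleSets D))

rmin : SetSystem n → ℕ
rmin {n} D = min n (map ∣_∣ (feasibleSets D))

ω : SetSystem n → ℕ
ω D = rmax D ∸ rmin D

-- { F △ A ∣ F ∈ 𝓕 }
twist : SetSystem n → Subset n → SetSystem n
twist D A X = does (anySubset? λ F → (F ∈ᶠ? D) ×-dec (X ≟ˢ (F △ A)))

-- 𝓕 △ { F ∪ {e} ∣ F ∈ 𝓕, e ∉ F }
loopComp₁ : SetSystem n → Fin n → SetSystem n
loopComp₁ D e X =
  D X xor does (anySubset? λ F →
    (F ∈ᶠ? D) ×-dec (¬? (e ∈? F) ×-dec (X ≟ˢ (F ∪ ⁅ e ⁆))))

-- Loop complementations on distinct elements commute, so processing A in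
-- increasing order is an inessential choice.
loopComp : SetSystem n → Subset n → SetSystem n
loopComp {n} D A = foldl loopComp₁ D (filter (_∈? A) (allFin n))

data Operation (n : ℕ) : Set where
  twistBy    : Subset n → Operation n
  loopCompBy : Subset n → Operation n

apply : SetSystem n → Operation n → SetSystem n
apply D (twistBy A)    = twist D A
apply D (loopCompBy A) = loopComp D A

VfSafe : SetSystem n → Set
VfSafe {n} D = (ops : List (Operation n)) → IsDeltaMatroid (foldl apply D ops)

-- The two words, read from left to right.
data Word : Set where
  *× ×* : Word

infixl 5 _^_∣_
_^_∣_ : SetSystem n → Word → Subset n → SetSystem n
D ^ *× ∣ A = loopComp (twist D A) A
D ^ ×* ∣ A = twist (loopComp D A) A

toSubset : List (Fin n) → Subset n
toSubset es = ⋃ (map ⁅_⁆ es)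

_IsOrderingOf_ : List (Fin n) → Subset n → Set
es IsOrderingOf A = Unique es × toSubset es ≡ A

maxOverSubsets : (Subset n → ℕ) → ℕ
maxOverSubsets {n} f = max 0 (map f (subsets n))

{-# OPTIONS --safe #-}
module Submission where

-- Write d_D(B) for the least distance |F △ B| from B to a feasible set F of D.  Loop
-- complementation preserves the smallest size of a feasible set, so
-- ω (D ^ σ ∣ B) = n ∸ (d_D₁(B) + d_D₂(B)) for two delta-matroids D₁, D₂ that do not depend on B.
-- If D is a delta-matroid, B ⊆ A and d_D(A) < d_D(B), the exchange axiom yields some e ∈ A ∖ B
-- with d_D(B ∪ e) < d_D(B), while no d_D grows by more than one when an element is added.  Hence,
-- as long as B ⊆ A gives a smaller width than a maximiser A, one of D₁, D₂ supplies an element of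
-- A ∖ B whose addition does not decrease the width; start from B = ∅.

open import Defs
open import Data.Bool.Base using (true; false; _∧_; _xor_; T)
open import Data.Bool.Properties
  using (T-≡; T-∧; ∨-identityʳ; xor-comm; xor-assoc; xor-identityʳ; true-xor)
open import Data.Bool.Solver using (module xor-∧-Solver)
open import Data.Fin.Base using (Fin; zero; suc)
open import Data.Fin.Properties using (any?) renaming (_≟_ to _≟ᶠ_)
open import Data.Fin.Subset
  using (Subset; inside; outside; _∈_; _∉_; _⊆_; _⊂_; _∪_; ⁅_⁆; ⊥; ⊤; ∁; ∣_∣)
open import Data.Fin.Subset.Induction using (⊃-wellFounded)
open import Data.Fin.Subset.Properties
open import Data.List.Base
  using (List; []; _∷_; map; inits; drop; filter; foldl; allFin)
open import Data.List.Extrema.Nat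
  using (min≤xs; v≤min⁺; xs≤max; max≤v⁺; argmin-sel; argmax-sel; min≤⊤)
open import Data.List.Membership.Propositional using () renaming (_∈_ to _∈ˡ_)
open import Data.List.Membership.Propositional.Properties
  using (∈-map⁺; ∈-map⁻; ∈-filter⁺; ∈-filter⁻; ∈-++⁺ˡ; ∈-++⁺ʳ)
open import Data.List.Properties using (filter-all; filter-none; map-cong; map-∘)
open import Data.List.Relation.Unary.All as All using (All; []; _∷_)
open import Data.List.Relation.Unary.All.Properties using (all-filter)
import Data.List.Relation.Unary.All.Properties as Allₚ
open import Data.List.Relation.Unary.AllPairs using ([]; _∷_)
open import Data.List.Relation.Unary.Any using (here)
open import Data.List.Relation.Unary.Linked using (Linked; [-]; _∷_)
open import Data.List.Relation.Unary.Unique.Propositional using (Unique)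
open import Data.Nat.Base using (ℕ; suc; _+_; _∸_; _≤_; _<_; z≤n; s≤s; s≤s⁻¹)
open import Data.Nat.Induction using (<-wellFounded)
open import Data.Nat.Properties
open import Data.Product.Base using (Σ-syntax; ∃-syntax; _×_; _,_; proj₂)
open import Data.Sum.Base using (inj₁; inj₂)
open import Data.Vec.Base using ([]; _∷_; here; there; lookup; _[_]≔_)
open import Data.Vec.Properties
  using (zipWith-assoc; zipWith-comm; zipWith-identityʳ; lookup-zipWith; lookup⇒[]=; []=⇒lookup;
         []≔-commutes; lookup∘update′)
open import Function.Base using (_∘_; case_of_)
open import Function.Bundles using (Equivalence; mk⇔)
open import Induction.WellFounded using (Acc; acc)
open import Relation.Binary.PropositionalEquality
open import Relation.Nullary.Decidable using (Dec; yes; no; does; does-⇔; dec-false; _×-dec_; ¬?)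
open import Relation.Nullary.Negation using (¬_; contradiction)

private
  variable
    n : ℕ

-- Symmetric differences and their cardinalities.

△-assoc : (X Y Z : Subset n) → (X △ Y) △ Z ≡ X △ (Y △ Z)
△-assoc = zipWith-assoc xor-assoc

△-comm : (X Y : Subset n) → X △ Y ≡ Y △ X
△-comm = zipWith-comm xor-comm

△-identityʳ : (X : Subset n) → X △ ⊥ ≡ X
△-identityʳ = zipWith-identityʳ xor-identityʳ

△-rightComm : (X Y Z : Subset n) → (X △ Y) △ Z ≡ (X △ Z) △ Y
△-rightComm X Y Z =
  trans (△-assoc X Y Z) (trans (cong (X △_) (△-comm Y Z)) (sym (△-assoc X Z Y)))

△-⊤ : (X : Subset n) → X △ ⊤ ≡ ∁ X
△-⊤ []      = refl
△-⊤ (x ∷ X) = cong₂ _∷_ (trans (xor-comm x true) (true-xor x)) (△-⊤ X)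

X△∁X≡⊤ : (X : Subset n) → X △ ∁ X ≡ ⊤
X△∁X≡⊤ []          = refl
X△∁X≡⊤ (true  ∷ X) = cong (true ∷_) (X△∁X≡⊤ X)
X△∁X≡⊤ (false ∷ X) = cong (true ∷_) (X△∁X≡⊤ X)

△-cancelʳ : (X Y : Subset n) → (X △ Y) △ Y ≡ X
△-cancelʳ []          []          = refl
△-cancelʳ (true  ∷ X) (true  ∷ Y) = cong (true ∷_) (△-cancelʳ X Y)
△-cancelʳ (true  ∷ X) (false ∷ Y) = cong (true ∷_) (△-cancelʳ X Y)
△-cancelʳ (false ∷ X) (true  ∷ Y) = cong (false ∷_) (△-cancelʳ X Y)
△-cancelʳ (false ∷ X) (false ∷ Y) = cong (false ∷_) (△-cancelʳ X Y)

∪-singleton : (X : Subset n) (e : Fin n) → e ∉ X → X ∪ ⁅ e ⁆ ≡ X △ ⁅ e ⁆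
∪-singleton (true  ∷ X) zero    e∉X = contradiction here e∉X
∪-singleton (false ∷ X) zero    _   =
  cong (true ∷_) (trans (∪-identityʳ X) (sym (△-identityʳ X)))
∪-singleton (true  ∷ X) (suc e) e∉X = cong (true ∷_) (∪-singleton X e (e∉X ∘ there))
∪-singleton (false ∷ X) (suc e) e∉X = cong (false ∷_) (∪-singleton X e (e∉X ∘ there))

∉⇒lookup : {X : Subset n} {e : Fin n} → e ∉ X → lookup X e ≡ false
∉⇒lookup {X = X} {e} e∉X with lookup X e in eq
... | true  = contradiction (lookup⇒[]= e X eq) e∉X
... | false = refl

lookup-△ : (X Y : Subset n) (e : Fin n) → lookup (X △ Y) e ≡ lookup X e xor lookup Y e
lookup-△ X Y e = lookup-zipWith _xor_ e X Y

∈-△⁺ : {X Y : Subset n} {e : Fin n} → lookup X e xor lookup Y e ≡ true → e ∈ X △ Y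
∈-△⁺ {X = X} {Y} {e} eq = lookup⇒[]= e (X △ Y) (trans (lookup-△ X Y e) eq)

∣X△⁅e⁆∣≤1+∣X∣ : (X : Subset n) (e : Fin n) → ∣ X △ ⁅ e ⁆ ∣ ≤ suc ∣ X ∣
∣X△⁅e⁆∣≤1+∣X∣ (true  ∷ X) zero    rewrite △-identityʳ X = m≤n+m ∣ X ∣ 2
∣X△⁅e⁆∣≤1+∣X∣ (false ∷ X) zero    rewrite △-identityʳ X = ≤-refl
∣X△⁅e⁆∣≤1+∣X∣ (true  ∷ X) (suc e) = s≤s (∣X△⁅e⁆∣≤1+∣X∣ X e)
∣X△⁅e⁆∣≤1+∣X∣ (false ∷ X) (suc e) = ∣X△⁅e⁆∣≤1+∣X∣ X e

1+∣X△⁅e⁆∣≡∣X∣ : (X : Subset n) {e : Fin n} → e ∈ X → suc ∣ X △ ⁅ e ⁆ ∣ ≡ ∣ X ∣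
1+∣X△⁅e⁆∣≡∣X∣ (true  ∷ X) here rewrite △-identityʳ X = refl
1+∣X△⁅e⁆∣≡∣X∣ (true  ∷ X) (there e∈X) = cong suc (1+∣X△⁅e⁆∣≡∣X∣ X e∈X)
1+∣X△⁅e⁆∣≡∣X∣ (false ∷ X) (there e∈X) = 1+∣X△⁅e⁆∣≡∣X∣ X e∈X

-- Removing `u` lowers the size by one and toggling `v` raises it by at most one; for `u = v` only
-- the removal happens. In an exchange this keeps a feasible set nearest to `B`.
∣X△⁅u,v⁆∣≤∣X∣ : (X : Subset n) {u : Fin n} (v : Fin n) → u ∈ X →
                ∣ X △ (⁅ u ⁆ ∪ ⁅ v ⁆) ∣ ≤ ∣ X ∣
∣X△⁅u,v⁆∣≤∣X∣ {suc n} (true ∷ X) zero here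
  rewrite ∪-idem (⊥ {n}) | △-identityʳ X = n≤1+n ∣ X ∣
∣X△⁅u,v⁆∣≤∣X∣ (true ∷ X) (suc v) here
  rewrite ∪-identityˡ ⁅ v ⁆ = ∣X△⁅e⁆∣≤1+∣X∣ X v
∣X△⁅u,v⁆∣≤∣X∣ (true ∷ X) {suc u} zero (there u∈X)
  rewrite ∪-identityʳ ⁅ u ⁆ = m≤n⇒m≤1+n (≤-trans (n≤1+n _) (≤-reflexive (1+∣X△⁅e⁆∣≡∣X∣ X u∈X)))
∣X△⁅u,v⁆∣≤∣X∣ (false ∷ X) {suc u} zero (there u∈X)
  rewrite ∪-identityʳ ⁅ u ⁆ = ≤-reflexive (1+∣X△⁅e⁆∣≡∣X∣ X u∈X)
∣X△⁅u,v⁆∣≤∣X∣ (true  ∷ X) (suc v) (there u∈X) = s≤s (∣X△⁅u,v⁆∣≤∣X∣ X v u∈X)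
∣X△⁅u,v⁆∣≤∣X∣ (false ∷ X) (suc v) (there u∈X) = ∣X△⁅u,v⁆∣≤∣X∣ X v u∈X

-- Provides the decreasing measure of the exchange argument: both exchanged elements lie in the
-- symmetric difference, and even `u = v` removes one of its elements.
∣X△⁅u,v⁆∣<∣X∣ : (X : Subset n) {u v : Fin n} → u ∈ X → v ∈ X →
                ∣ X △ (⁅ u ⁆ ∪ ⁅ v ⁆) ∣ < ∣ X ∣
∣X△⁅u,v⁆∣<∣X∣ {suc n} (true ∷ X) here here
  rewrite ∪-idem (⊥ {n}) | △-identityʳ X = ≤-refl
∣X△⁅u,v⁆∣<∣X∣ (true ∷ X) {v = suc v} here (there v∈X)
  rewrite ∪-identityˡ ⁅ v ⁆ = s≤s (≤-trans (n≤1+n _) (≤-reflexive (1+∣X△⁅e⁆∣≡∣X∣ X v∈X)))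
∣X△⁅u,v⁆∣<∣X∣ (true ∷ X) {suc u} (there u∈X) here
  rewrite ∪-identityʳ ⁅ u ⁆ = s≤s (≤-trans (n≤1+n _) (≤-reflexive (1+∣X△⁅e⁆∣≡∣X∣ X u∈X)))
∣X△⁅u,v⁆∣<∣X∣ (true  ∷ X) (there u∈X) (there v∈X) = s≤s (∣X△⁅u,v⁆∣<∣X∣ X u∈X v∈X)
∣X△⁅u,v⁆∣<∣X∣ (false ∷ X) (there u∈X) (there v∈X) = ∣X△⁅u,v⁆∣<∣X∣ X u∈X v∈X

∣X∣<∣Y∣⇒Y⊈X : (X Y : Subset n) → ∣ X ∣ < ∣ Y ∣ → ∃[ e ] (e ∈ Y × e ∉ X)
∣X∣<∣Y∣⇒Y⊈X X Y ∣X∣<∣Y∣ with any? (λ e → e ∈? Y ×-dec ¬? (e ∈? X))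
... | yes found = found
... | no  none  = contradiction (p⊆q⇒∣p∣≤∣q∣ Y⊆X) (<⇒≱ ∣X∣<∣Y∣)
  where
  Y⊆X : Y ⊆ X
  Y⊆X {e} e∈Y with e ∈? X
  ... | yes e∈X = e∈X
  ... | no  e∉X = contradiction (e , e∈Y , e∉X) none

-- Twists and loop complementations on characteristic functions.

infix 4 _≐_
_≐_ : SetSystem n → SetSystem n → Set
D ≐ D′ = ∀ X → D X ≡ D′ X

-- Twisting by `A` is an involution on subsets, so the only candidate for `F` in the definition is
-- `X △ A`.
twist-apply : (D : SetSystem n) (A X : Subset n) → twist D A X ≡ D (X △ A)
twist-apply D A X = does-⇔ (mk⇔ to from) (anySubset? _) ((X △ A) ∈ᶠ? D)
  where
  to : (∃[ F ] (F ∈ᶠ D × X ≡ F △ A)) → (X △ A) ∈ᶠ D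
  to (F , F∈D , refl) = subst T (cong D (sym (△-cancelʳ F A))) F∈D
  from : (X △ A) ∈ᶠ D → ∃[ F ] (F ∈ᶠ D × X ≡ F △ A)
  from h = X △ A , h , sym (△-cancelʳ X A)

twist-∈⁺ : (D : SetSystem n) (A : Subset n) {F : Subset n} → F ∈ᶠ D → (F △ A) ∈ᶠ twist D A
twist-∈⁺ D A {F} =
  subst T (sym (trans (twist-apply D A (F △ A)) (cong D (△-cancelʳ F A))))

[]≔-∪ : (X : Subset n) (e : Fin n) → e ∈ X → (X [ e ]≔ outside) ∪ ⁅ e ⁆ ≡ X
[]≔-∪ (true ∷ X) zero    here        = cong (true ∷_) (∪-identityʳ X)
[]≔-∪ (x    ∷ X) (suc e) (there e∈X) = cong₂ _∷_ (∨-identityʳ x) ([]≔-∪ X e e∈X)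

∪-[]≔ : (F : Subset n) (e : Fin n) → e ∉ F → (F ∪ ⁅ e ⁆) [ e ]≔ outside ≡ F
∪-[]≔ (true  ∷ F) zero    e∉F = contradiction here e∉F
∪-[]≔ (false ∷ F) zero    e∉F = cong (false ∷_) (∪-identityʳ F)
∪-[]≔ (x     ∷ F) (suc e) e∉F = cong₂ _∷_ (∨-identityʳ x) (∪-[]≔ F e (e∉F ∘ there))

∉-[]≔ : (X : Subset n) (e : Fin n) → e ∉ X [ e ]≔ outside
∉-[]≔ (_ ∷ X) (suc e) (there p) = ∉-[]≔ X e p

∣[]≔∣≤ : (X : Subset n) (e : Fin n) → ∣ X [ e ]≔ outside ∣ ≤ ∣ X ∣
∣[]≔∣≤ (true  ∷ X) zero    = n≤1+n _
∣[]≔∣≤ (false ∷ X) zero    = ≤-refl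
∣[]≔∣≤ (true  ∷ X) (suc e) = s≤s (∣[]≔∣≤ X e)
∣[]≔∣≤ (false ∷ X) (suc e) = ∣[]≔∣≤ X e

-- If `e ∈ X`, the only `F` avoiding `e` with `X ≡ F ∪ ⁅ e ⁆` is `X` without `e`; if `e ∉ X` there
-- is none. The result is a polynomial expression over the field of two elements.
loopComp₁-apply : (D : SetSystem n) (e : Fin n) (X : Subset n) →
  loopComp₁ D e X ≡ D X xor (lookup X e ∧ D (X [ e ]≔ outside))
loopComp₁-apply D e X = cong (D X xor_) (helper (e ∈? X))
  where
  P? = anySubset? λ F → (F ∈ᶠ? D) ×-dec (¬? (e ∈? F) ×-dec (X ≟ˢ (F ∪ ⁅ e ⁆)))
  helper : Dec (e ∈ X) → does P? ≡ lookup X e ∧ D (X [ e ]≔ outside)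
  helper (yes e∈X) rewrite []=⇒lookup e∈X =
    does-⇔ (mk⇔ to from) P? ((X [ e ]≔ outside) ∈ᶠ? D)
    where
    to : (∃[ F ] (F ∈ᶠ D × e ∉ F × X ≡ F ∪ ⁅ e ⁆)) → (X [ e ]≔ outside) ∈ᶠ D
    to (F , F∈D , e∉F , refl) = subst T (cong D (sym (∪-[]≔ F e e∉F))) F∈D
    from : (X [ e ]≔ outside) ∈ᶠ D → ∃[ F ] (F ∈ᶠ D × e ∉ F × X ≡ F ∪ ⁅ e ⁆)
    from h = X [ e ]≔ outside , h , ∉-[]≔ X e , sym ([]≔-∪ X e e∈X)
  helper (no e∉X) rewrite ∉⇒lookup e∉X =
    dec-false P? λ { (F , _ , _ , refl) → e∉X (q⊆p∪q F ⁅ e ⁆ (x∈⁅x⁆ e)) }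

twist-cong : {D D′ : SetSystem n} (A : Subset n) → D ≐ D′ → twist D A ≐ twist D′ A
twist-cong {D = D} {D′} A eq X =
  trans (twist-apply D A X) (trans (eq (X △ A)) (sym (twist-apply D′ A X)))

loopComp₁-cong : {D D′ : SetSystem n} (e : Fin n) → D ≐ D′ → loopComp₁ D e ≐ loopComp₁ D′ e
loopComp₁-cong {D = D} {D′} e eq X =
  trans (loopComp₁-apply D e X)
    (trans (cong₂ (λ a b → a xor (lookup X e ∧ b)) (eq X) (eq (X [ e ]≔ outside)))
           (sym (loopComp₁-apply D′ e X)))

twist-twist : (D : SetSystem n) (A C : Subset n) → twist (twist D A) C ≐ twist D (A △ C)
twist-twist D A C X = begin
  twist (twist D A) C X  ≡⟨ twist-apply (twist D A) C X ⟩
  twist D A (X △ C)      ≡⟨ twist-apply D A (X △ C) ⟩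
  D ((X △ C) △ A)        ≡⟨ cong D (△-rightComm X C A) ⟩
  D ((X △ A) △ C)        ≡⟨ cong D (△-assoc X A C) ⟩
  D (X △ (A △ C))        ≡⟨ twist-apply D (A △ C) X ⟨
  twist D (A △ C) X      ∎
  where open ≡-Reasoning

[]≔-△ : (X A : Subset n) (e : Fin n) → e ∉ A → (X △ A) [ e ]≔ outside ≡ (X [ e ]≔ outside) △ A
[]≔-△ (x ∷ X) (true  ∷ A) zero    e∉A = contradiction here e∉A
[]≔-△ (x ∷ X) (false ∷ A) zero    e∉A = refl
[]≔-△ (x ∷ X) (a     ∷ A) (suc e) e∉A = cong ((x xor a) ∷_) ([]≔-△ X A e (e∉A ∘ there))

-- As `e ∉ A`, the symmetric difference with `A` neither affects membership of `e` nor interferes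
-- with its deletion.
twist-loopComp₁ : (D : SetSystem n) {A : Subset n} {e : Fin n} → e ∉ A →
  twist (loopComp₁ D e) A ≐ loopComp₁ (twist D A) e
twist-loopComp₁ D {A} {e} e∉A X = begin
  twist (loopComp₁ D e) A X
    ≡⟨ twist-apply (loopComp₁ D e) A X ⟩
  loopComp₁ D e (X △ A)
    ≡⟨ loopComp₁-apply D e (X △ A) ⟩
  D (X △ A) xor (lookup (X △ A) e ∧ D ((X △ A) [ e ]≔ outside))
    ≡⟨ cong₂ (λ b Y → D (X △ A) xor (b ∧ D Y)) same ([]≔-△ X A e e∉A) ⟩
  D (X △ A) xor (lookup X e ∧ D ((X [ e ]≔ outside) △ A))
    ≡⟨ cong₂ (λ a b → a xor (lookup X e ∧ b)) (twist-apply D A X)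
             (twist-apply D A (X [ e ]≔ outside)) ⟨
  twist D A X xor (lookup X e ∧ twist D A (X [ e ]≔ outside))
    ≡⟨ loopComp₁-apply (twist D A) e X ⟨
  loopComp₁ (twist D A) e X ∎
  where
  open ≡-Reasoning
  same : lookup (X △ A) e ≡ lookup X e
  same = trans (lookup-△ X A e)
           (trans (cong (lookup X e xor_) (∉⇒lookup e∉A)) (xor-identityʳ (lookup X e)))

-- For `e ≢ f`, both sides are the same sum over the two-element field: the values of `D` at `X`
-- with none, one or both of `e`, `f` deleted, weighted by the membership bits of the deleted
-- elements.
loopComp₁-comm : (D : SetSystem n) (e f : Fin n) →
  loopComp₁ (loopComp₁ D e) f ≐ loopComp₁ (loopComp₁ D f) e
loopComp₁-comm D e f X with e ≟ᶠ f
... | yes refl = refl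
... | no  e≢f  = begin
  loopComp₁ (loopComp₁ D e) f X
    ≡⟨ expand D e f e≢f ⟩
  (D X xor (a ∧ D Xe)) xor (b ∧ (D Xf xor (a ∧ D (Xf [ e ]≔ outside))))
    ≡⟨ cong (λ Y → (D X xor (a ∧ D Xe)) xor (b ∧ (D Xf xor (a ∧ D Y))))
            ([]≔-commutes X f e (e≢f ∘ sym)) ⟩
  (D X xor (a ∧ D Xe)) xor (b ∧ (D Xf xor (a ∧ D (Xe [ f ]≔ outside))))
    ≡⟨ shuffle a b (D X) (D Xe) (D Xf) (D (Xe [ f ]≔ outside)) ⟩
  (D X xor (b ∧ D Xf)) xor (a ∧ (D Xe xor (b ∧ D (Xe [ f ]≔ outside))))
    ≡⟨ expand D f e (e≢f ∘ sym) ⟨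
  loopComp₁ (loopComp₁ D f) e X ∎
  where
  open ≡-Reasoning
  open xor-∧-Solver using (solve; _:=_; _:+_; _:*_)
  a  = lookup X e
  b  = lookup X f
  Xe = X [ e ]≔ outside
  Xf = X [ f ]≔ outside
  expand : ∀ D e f → e ≢ f → loopComp₁ (loopComp₁ D e) f X ≡
    (D X xor (lookup X e ∧ D (X [ e ]≔ outside))) xor
    (lookup X f ∧ (D (X [ f ]≔ outside) xor
      (lookup X e ∧ D ((X [ f ]≔ outside) [ e ]≔ outside))))
  expand D e f e≢f =
    trans (loopComp₁-apply (loopComp₁ D e) f X)
      (cong₂ (λ p q → p xor (lookup X f ∧ q)) (loopComp₁-apply D e X)
        (trans (loopComp₁-apply D e (X [ f ]≔ outside))
          (cong (λ c → D (X [ f ]≔ outside) xor (c ∧ D ((X [ f ]≔ outside) [ e ]≔ outside)))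
            (lookup∘update′ e≢f X outside))))
  shuffle : ∀ a b x y z w →
    (x xor (a ∧ y)) xor (b ∧ (z xor (a ∧ w))) ≡ (x xor (b ∧ z)) xor (a ∧ (y xor (b ∧ w)))
  shuffle = solve 6 (λ a b x y z w →
    ((x :+ (a :* y)) :+ (b :* (z :+ (a :* w)))) := ((x :+ (b :* z)) :+ (a :* (y :+ (b :* w))))) refl

loopComps : SetSystem n → List (Fin n) → SetSystem n
loopComps = foldl loopComp₁

loopComps-cong : {D D′ : SetSystem n} (es : List (Fin n)) → D ≐ D′ →
  loopComps D es ≐ loopComps D′ es
loopComps-cong []       eq = eq
loopComps-cong (e ∷ es) eq = loopComps-cong es (loopComp₁-cong e eq)

twist-loopComps : (D : SetSystem n) {A : Subset n} {es : List (Fin n)} → All (_∉ A) es →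
  twist (loopComps D es) A ≐ loopComps (twist D A) es
twist-loopComps D             []           X = refl
twist-loopComps D {es = e ∷ es} (e∉A ∷ es∉A) X =
  trans (twist-loopComps (loopComp₁ D e) es∉A X)
        (loopComps-cong es (twist-loopComp₁ D e∉A) X)

loopComps-comm₁ : (D : SetSystem n) (e : Fin n) (es : List (Fin n)) →
  loopComps (loopComp₁ D e) es ≐ loopComp₁ (loopComps D es) e
loopComps-comm₁ D e []       X = refl
loopComps-comm₁ D e (f ∷ es) X =
  trans (loopComps-cong es (loopComp₁-comm D e f) X) (loopComps-comm₁ (loopComp₁ D f) e es X)

-- Each element of the list passes exactly one of the two filters. One outside `A` is moved to the
-- front, past the loop complementations inside `A`, to restore the order of the list.
loopComps-filter-∁ : (D : SetSystem n) (A : Subset n) (es : List (Fin n)) →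
  loopComps (loopComps D (filter (_∈? A) es)) (filter (_∈? ∁ A) es) ≐ loopComps D es
loopComps-filter-∁ D A []       X = refl
loopComps-filter-∁ D A (e ∷ es) X with e ∈? A | e ∈? ∁ A
... | yes _   | no  _    = loopComps-filter-∁ (loopComp₁ D e) A es X
... | no  _   | yes _    =
  trans (sym (loopComps-cong (filter (_∈? ∁ A) es) (loopComps-comm₁ D e (filter (_∈? A) es)) X))
        (loopComps-filter-∁ (loopComp₁ D e) A es X)
... | yes e∈A | yes e∈∁A = contradiction e∈∁A (x∈p⇒x∉∁p e∈A)
... | no  e∉A | no  e∉∁A = contradiction (x∉p⇒x∈∁p e∉A) e∉∁A

loopComp-cong : {D D′ : SetSystem n} (A : Subset n) → D ≐ D′ → loopComp D A ≐ loopComp D′ A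
loopComp-cong A = loopComps-cong (filter (_∈? A) (allFin _))

twist-loopComp : (D : SetSystem n) (A C : Subset n) → (∀ {e} → e ∈ C → e ∉ A) →
  twist (loopComp D C) A ≐ loopComp (twist D A) C
twist-loopComp D A C disj = twist-loopComps D (All.map disj (all-filter (_∈? C) (allFin _)))

loopComp-∁ : (D : SetSystem n) (A : Subset n) → loopComp (loopComp D A) (∁ A) ≐ loopComp D ⊤
loopComp-∁ D A X =
  trans (loopComps-filter-∁ D A (allFin _) X)
    (cong (λ es → loopComps D es X)
      (sym (filter-all (_∈? ⊤) (All.universal (λ _ → ∈⊤) (allFin _)))))

twist-⊥ : (D : SetSystem n) → twist D ⊥ ≐ D
twist-⊥ D X = trans (twist-apply D ⊥ X) (cong D (△-identityʳ X))

loopComp-⊥ : (D : SetSystem n) → loopComp D ⊥ ≐ D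
loopComp-⊥ D X =
  cong (λ es → loopComps D es X) (filter-none (_∈? ⊥) (All.universal (λ _ → ∉⊥) (allFin _)))

-- Extreme cardinalities and the width.

∈-subsets : (X : Subset n) → X ∈ˡ subsets n
∈-subsets []          = here refl
∈-subsets {suc n} (false ∷ X) = ∈-++⁺ˡ (∈-map⁺ (outside ∷_) (∈-subsets X))
∈-subsets {suc n} (true ∷ X) =
  ∈-++⁺ʳ (map (outside ∷_) (subsets n)) (∈-map⁺ (inside ∷_) (∈-subsets X))

module _ {n} (D : SetSystem n) where

  ∣∣-∈ : {X : Subset n} → X ∈ᶠ D → ∣ X ∣ ∈ˡ map ∣_∣ (feasibleSets D)
  ∣∣-∈ {X} X∈D = ∈-map⁺ ∣_∣ (∈-filter⁺ (_∈ᶠ? D) (∈-subsets X) X∈D)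

  rmin≤ : {X : Subset n} → X ∈ᶠ D → rmin D ≤ ∣ X ∣
  rmin≤ X∈D = All.lookup (min≤xs n (map ∣_∣ (feasibleSets D))) (∣∣-∈ X∈D)

  ≤rmax : {X : Subset n} → X ∈ᶠ D → ∣ X ∣ ≤ rmax D
  ≤rmax X∈D = All.lookup (xs≤max 0 (map ∣_∣ (feasibleSets D))) (∣∣-∈ X∈D)

  -- The bound `k ≤ n` accounts for `n` being the starting value of the minimum.
  rmin-greatest : {k : ℕ} → k ≤ n → (∀ X → X ∈ᶠ D → k ≤ ∣ X ∣) → k ≤ rmin D
  rmin-greatest k≤n h =
    v≤min⁺ k≤n (Allₚ.map⁺ (All.map (λ {X} → h X) (all-filter (_∈ᶠ? D) (subsets n))))

  rmax-least : {k : ℕ} → (∀ X → X ∈ᶠ D → ∣ X ∣ ≤ k) → rmax D ≤ k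
  rmax-least h =
    max≤v⁺ z≤n (Allₚ.map⁺ (All.map (λ {X} → h X) (all-filter (_∈ᶠ? D) (subsets n))))

  rmin≤n : rmin D ≤ n
  rmin≤n = min≤⊤ n (map ∣_∣ (feasibleSets D))

  rmin-attained : Proper D → ∃[ X ] (X ∈ᶠ D × ∣ X ∣ ≤ rmin D)
  rmin-attained (Y , Y∈D) with argmin-sel (λ k → k) n (map ∣_∣ (feasibleSets D))
  -- If the starting value `n` is the minimum, any feasible set is small enough.
  ... | inj₁ eq = Y , Y∈D , ≤-trans (∣p∣≤n Y) (≤-reflexive (sym eq))
  ... | inj₂ r∈ with ∈-map⁻ ∣_∣ r∈
  ... | X , X∈ , eq = X , proj₂ (∈-filter⁻ (_∈ᶠ? D) {xs = subsets n} X∈) , ≤-reflexive (sym eq)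

rmin-mono : (D D′ : SetSystem n) (c : ℕ) →
  (∀ X → X ∈ᶠ D → ∃[ Y ] (Y ∈ᶠ D′ × ∣ Y ∣ ≤ c + ∣ X ∣)) → rmin D′ ≤ c + rmin D
rmin-mono D D′ c h = ≤-trans (m≤n+m∸n (rmin D′) c) (+-monoʳ-≤ c
  (rmin-greatest D (≤-trans (m∸n≤m (rmin D′) c) (rmin≤n D′)) λ X X∈D →
    let Y , Y∈D′ , ∣Y∣≤ = h X X∈D
    in m≤n+o⇒m∸n≤o (rmin D′) c (≤-trans (rmin≤ D′ Y∈D′) ∣Y∣≤)))

rmin-cong : {D D′ : SetSystem n} → D ≐ D′ → rmin D ≡ rmin D′
rmin-cong {D = D} {D′} eq = ≤-antisym
  (rmin-mono D′ D 0 λ X X∈D′ → X , subst T (sym (eq X)) X∈D′ , ≤-refl)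
  (rmin-mono D D′ 0 λ X X∈D → X , subst T (eq X) X∈D , ≤-refl)

-- A set gains or loses feasibility only if it contains `e` and deleting `e` gives a feasible set.
-- That smaller set avoids `e`, so its own feasibility is unchanged, and it can replace the larger
-- one in either direction.
rmin-loopComp₁ : (D : SetSystem n) (e : Fin n) → rmin (loopComp₁ D e) ≡ rmin D
rmin-loopComp₁ {n} D e = ≤-antisym
  (rmin-mono D (loopComp₁ D e) 0 forth) (rmin-mono (loopComp₁ D e) D 0 back)
  where
  forth : ∀ X → X ∈ᶠ D → ∃[ Y ] (Y ∈ᶠ loopComp₁ D e × ∣ Y ∣ ≤ ∣ X ∣)
  forth X X∈D with lookup X e ∧ D (X [ e ]≔ outside) in eq
  ... | false = X , subst T (sym (trans (loopComp₁-apply D e X)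
                      (trans (cong (D X xor_) eq) (xor-identityʳ (D X))))) X∈D , ≤-refl
  ... | true  = X′ , subst T (sym step) X′∈D , ∣[]≔∣≤ X e
    where
    X′ = X [ e ]≔ outside
    X′∈D : X′ ∈ᶠ D
    X′∈D = proj₂ (Equivalence.to T-∧ (Equivalence.from T-≡ eq))
    step : loopComp₁ D e X′ ≡ D X′
    step = trans (loopComp₁-apply D e X′)
      (trans (cong (λ b → D X′ xor (b ∧ D (X′ [ e ]≔ outside))) (∉⇒lookup (∉-[]≔ X e)))
             (xor-identityʳ (D X′)))
  back : ∀ X → X ∈ᶠ loopComp₁ D e → ∃[ Y ] (Y ∈ᶠ D × ∣ Y ∣ ≤ ∣ X ∣)
  back X X∈D′ with D X in eq | lookup X e ∧ D (X [ e ]≔ outside) in eq′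
                 | subst T (loopComp₁-apply D e X) X∈D′
  ... | true  | _    | _ = X , Equivalence.from T-≡ eq , ≤-refl
  ... | false | true | _ = X [ e ]≔ outside ,
    proj₂ (Equivalence.to T-∧ (Equivalence.from T-≡ eq′)) , ∣[]≔∣≤ X e

rmin-loopComp : (D : SetSystem n) (A : Subset n) → rmin (loopComp D A) ≡ rmin D
rmin-loopComp D A = go D (filter (_∈? A) (allFin _))
  where
  go : ∀ D es → rmin (loopComps D es) ≡ rmin D
  go D []       = refl
  go D (e ∷ es) = trans (go (loopComp₁ D e) es) (rmin-loopComp₁ D e)

-- Twisting by the whole ground set complements every feasible set and so exchanges largest and
-- smallest.
rmax≡n∸rmin : (D : SetSystem n) → rmax D ≡ n ∸ rmin (twist D ⊤)
rmax≡n∸rmin {n} D = ≤-antisym (rmax-least D upper)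
  (m≤n+o⇒m∸n≤o n (rmin (twist D ⊤)) (begin
    n                            ≤⟨ m≤n+m∸n n (rmax D) ⟩
    rmax D + (n ∸ rmax D)        ≤⟨ +-monoʳ-≤ (rmax D)
                                      (rmin-greatest (twist D ⊤) (m∸n≤m n (rmax D)) lower) ⟩
    rmax D + rmin (twist D ⊤)    ≡⟨ +-comm (rmax D) (rmin (twist D ⊤)) ⟩
    rmin (twist D ⊤) + rmax D    ∎))
  where
  open ≤-Reasoning
  ∣X△⊤∣ : ∀ X → ∣ X △ ⊤ ∣ ≡ n ∸ ∣ X ∣
  ∣X△⊤∣ X = trans (cong ∣_∣ (△-⊤ X)) (∣∁p∣≡n∸∣p∣ X)
  upper : ∀ X → X ∈ᶠ D → ∣ X ∣ ≤ n ∸ rmin (twist D ⊤)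
  upper X X∈D = subst (_≤ n ∸ rmin (twist D ⊤)) (m∸[m∸n]≡n (∣p∣≤n X))
    (∸-monoʳ-≤ n (subst (rmin (twist D ⊤) ≤_) (∣X△⊤∣ X)
      (rmin≤ (twist D ⊤) (twist-∈⁺ D ⊤ X∈D))))
  lower : ∀ X → X ∈ᶠ twist D ⊤ → n ∸ rmax D ≤ ∣ X ∣
  lower X X∈ = subst (n ∸ rmax D ≤_) (m∸[m∸n]≡n (∣p∣≤n X))
    (∸-monoʳ-≤ n (subst (_≤ rmax D) (∣X△⊤∣ X) (≤rmax D (subst T (twist-apply D ⊤ X) X∈))))

-- Expresses the width by minima alone, because minima are what loop complementation preserves.
ω-rmin : (D : SetSystem n) → ω D ≡ n ∸ (rmin (twist D ⊤) + rmin D)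
ω-rmin {n} D = trans (cong (_∸ rmin D) (rmax≡n∸rmin D)) (∸-+-assoc n (rmin (twist D ⊤)) (rmin D))

ω-cong : {D D′ : SetSystem n} → D ≐ D′ → ω D ≡ ω D′
ω-cong {n} {D} {D′} eq = trans (ω-rmin D)
  (trans (cong₂ (λ a b → n ∸ (a + b)) (rmin-cong (twist-cong ⊤ eq)) (rmin-cong eq))
         (sym (ω-rmin D′)))

-- Distance to the nearest feasible set, and the exchange argument.

dist : SetSystem n → Subset n → ℕ
dist D B = rmin (twist D B)

dist≤ : (D : SetSystem n) (B : Subset n) {F : Subset n} → F ∈ᶠ D → dist D B ≤ ∣ F △ B ∣
dist≤ D B F∈D = rmin≤ (twist D B) (twist-∈⁺ D B F∈D)

dist-attained : (D : SetSystem n) → Proper D → (B : Subset n) →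
  ∃[ F ] (F ∈ᶠ D × ∣ F △ B ∣ ≤ dist D B)
dist-attained D (F₀ , F₀∈D) B
  with rmin-attained (twist D B) (F₀ △ B , twist-∈⁺ D B F₀∈D)
... | X , X∈ , ∣X∣≤ = X △ B , subst T (twist-apply D B X) X∈ ,
                      ≤-trans (≤-reflexive (cong ∣_∣ (△-cancelʳ X B))) ∣X∣≤

-- For a feasible `F` nearest to `B`, adding `e` to `B` changes `F △ B` only at `e`.
dist-∪≤ : (D : SetSystem n) → Proper D → (B : Subset n) {e : Fin n} → e ∉ B →
  dist D (B ∪ ⁅ e ⁆) ≤ suc (dist D B)
dist-∪≤ D prop B {e} e∉B with dist-attained D prop B
... | F , F∈D , ∣F△B∣≤ = begin
  dist D (B ∪ ⁅ e ⁆)        ≤⟨ dist≤ D (B ∪ ⁅ e ⁆) F∈D ⟩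
  ∣ F △ (B ∪ ⁅ e ⁆) ∣       ≡⟨ cong (λ Y → ∣ F △ Y ∣) (∪-singleton B e e∉B) ⟩
  ∣ F △ (B △ ⁅ e ⁆) ∣       ≡⟨ cong ∣_∣ (△-assoc F B ⁅ e ⁆) ⟨
  ∣ (F △ B) △ ⁅ e ⁆ ∣       ≤⟨ ∣X△⁅e⁆∣≤1+∣X∣ (F △ B) e ⟩
  suc ∣ F △ B ∣             ≤⟨ s≤s ∣F△B∣≤ ⟩
  suc (dist D B)            ∎
  where open ≤-Reasoning

module _ {n} {D : SetSystem n} (dm : IsDeltaMatroid D) {A B : Subset n} (B⊆A : B ⊆ A) where
  open IsDeltaMatroid dm

  Closer : Fin n → Set
  Closer e = e ∈ A × e ∉ B × dist D (B ∪ ⁅ e ⁆) < dist D B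

  private
    -- If `u ∈ F`, then `u ∉ B`, so `u ∉ A` because `F` misses `A` outside `B`; hence `u ∉ F′`. If
    -- `u ∉ F`, then `u ∈ B ⊆ A`, hence `u ∈ F′`.
    disagree : (F F′ : Subset n) → ¬ (∃[ e ] (e ∈ A × e ∉ B × e ∈ F)) →
      ∀ {u} → u ∈ F △ B → u ∉ F′ △ A → u ∈ F △ F′
    disagree F F′ none {u} u∈F△B u∉F′△A = ∈-△⁺ {X = F} {F′} go
      where
      xor-true : ∀ b → b xor true ≡ false → b ≡ true
      xor-true true _ = refl
      go : lookup F u xor lookup F′ u ≡ true
      go with u ∈? F | u ∈? B | u ∈? A
            | trans (sym (lookup-△ F B u)) ([]=⇒lookup u∈F△B)
            | trans (sym (lookup-△ F′ A u)) (∉⇒lookup u∉F′△A)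
      ... | yes p | yes q | _     | h | _ rewrite []=⇒lookup p | []=⇒lookup q = case h of λ ()
      ... | yes p | no  q | yes r | _ | _ = contradiction (u , r , q , p) none
      ... | yes p | no  q | no  r | h | k
        rewrite []=⇒lookup p | ∉⇒lookup r | xor-identityʳ (lookup F′ u) | k = refl
      ... | no  p | yes q | _     | h | k
        rewrite ∉⇒lookup p | []=⇒lookup (B⊆A q) = xor-true (lookup F′ u) k
      ... | no  p | no  q | _     | h | _ rewrite ∉⇒lookup p | ∉⇒lookup q = case h of λ ()

    -- Unless F meets A ∖ B, an exchange replaces it by a set that is still nearest to B but nearer
    -- to F′.
    search : (F F′ : Subset n) → Acc _<_ ∣ F △ F′ ∣ → F ∈ᶠ D → F′ ∈ᶠ D →
      ∣ F △ B ∣ ≤ dist D B → ∣ F′ △ A ∣ < dist D B → ∃[ e ] Closer e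
    search F F′ (acc rec) F∈D F′∈D ∣F△B∣≤ ∣F′△A∣<
      with any? (λ e → e ∈? A ×-dec ¬? (e ∈? B) ×-dec e ∈? F)
    -- Since `e` is in `F` but not in `B`, adding it to `B` deletes it from `F △ B`, whose size is
    -- already the distance from `B`.
    ... | yes (e , e∈A , e∉B , e∈F) = e , e∈A , e∉B , (begin
      suc (dist D (B ∪ ⁅ e ⁆))   ≤⟨ s≤s (dist≤ D (B ∪ ⁅ e ⁆) F∈D) ⟩
      suc ∣ F △ (B ∪ ⁅ e ⁆) ∣    ≡⟨ cong (λ Y → suc ∣ F △ Y ∣) (∪-singleton B e e∉B) ⟩
      suc ∣ F △ (B △ ⁅ e ⁆) ∣    ≡⟨ cong (suc ∘ ∣_∣) (△-assoc F B ⁅ e ⁆) ⟨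
      suc ∣ (F △ B) △ ⁅ e ⁆ ∣    ≡⟨ 1+∣X△⁅e⁆∣≡∣X∣ (F △ B) e∈F△B ⟩
      ∣ F △ B ∣                  ≤⟨ ∣F△B∣≤ ⟩
      dist D B                   ∎)
      where
      open ≤-Reasoning
      e∈F△B : e ∈ F △ B
      e∈F△B = ∈-△⁺ {X = F} {B} (cong₂ _xor_ ([]=⇒lookup e∈F) (∉⇒lookup e∉B))
    ... | no none
      -- `F △ B` has at least `dist D B` elements and `F′ △ A` has fewer, so some `u` lies in the
      -- former only.
      with ∣X∣<∣Y∣⇒Y⊈X (F′ △ A) (F △ B) (<-≤-trans ∣F′△A∣< (dist≤ D B F∈D))
    ... | u , u∈F△B , u∉F′△A
      with disagree F F′ none u∈F△B u∉F′△A
    ... | u∈F△F′ with exchange F F′ F∈D F′∈D u u∈F△F′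
    ... | v , v∈F△F′ , G∈D = search G F′ (rec closer) G∈D F′∈D ∣G△B∣≤ ∣F′△A∣<
      where
      P = ⁅ u ⁆ ∪ ⁅ v ⁆
      G = F △ P
      ∣G△B∣≤ : ∣ G △ B ∣ ≤ dist D B
      ∣G△B∣≤ = ≤-trans (≤-reflexive (cong ∣_∣ (△-rightComm F P B)))
                 (≤-trans (∣X△⁅u,v⁆∣≤∣X∣ (F △ B) v u∈F△B) ∣F△B∣≤)
      closer : ∣ G △ F′ ∣ < ∣ F △ F′ ∣
      closer = ≤-trans (s≤s (≤-reflexive (cong ∣_∣ (△-rightComm F P F′))))
                 (∣X△⁅u,v⁆∣<∣X∣ (F △ F′) u∈F△F′ v∈F△F′)

  -- Take feasible sets nearest to `B` and to `A`. Exchanging the first towards the second must at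
  -- some stage make it meet `A` outside `B`, since every exchange brings the two closer; an element
  -- of that intersection is the one sought.
  approach : dist D A < dist D B → ∃[ e ] Closer e
  approach A<B with dist-attained D proper B | dist-attained D proper A
  ... | F , F∈D , ∣F△B∣≤ | F′ , F′∈D , ∣F′△A∣≤ =
    search F F′ (<-wellFounded _) F∈D F′∈D ∣F△B∣≤ (≤-<-trans ∣F′△A∣≤ A<B)

-- Climbing by single elements to a maximum of a set function.

module _ {n} (g : Subset n → ℕ) where

  -- `drop 1` discards the empty prefix, whose value `g B` is written as a separate head. The offset
  -- `B` lets the sequence be continued from an enlarged set.
  widths : Subset n → List (Fin n) → List ℕ
  widths B es = map (λ p → g (B ∪ toSubset p)) (drop 1 (inits es))

  widths-∷ : ∀ B e es → widths B (e ∷ es) ≡ g (B ∪ ⁅ e ⁆) ∷ widths (B ∪ ⁅ e ⁆) es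
  widths-∷ B e es = cong₂ _∷_ (cong (g ∘ (B ∪_)) (∪-identityʳ ⁅ e ⁆))
    (trans (sym (map-∘ (drop 1 (inits es))))
           (map-cong (λ p → cong g (sym (∪-assoc B ⁅ e ⁆ (toSubset p)))) (drop 1 (inits es))))

  -- The step is repeated while the value is below `g A`; it ends because `B` grows strictly.
  -- Freshness of the list with respect to the current set makes its elements distinct.
  ascend : {A : Subset n} →
    (∀ {B} → B ⊆ A → g B < g A → ∃[ e ] (e ∈ A × e ∉ B × g B ≤ g (B ∪ ⁅ e ⁆))) →
    ∀ {B} → B ⊆ A → Acc (λ X Y → Y ⊂ X) B →
    ∃[ es ] (Unique es × All (_∉ B) es × g A ≤ g (B ∪ toSubset es) × Linked _≤_ (g B ∷ widths B es))
  ascend {A} step {B} B⊆A (acc rec) with g A ≤? g B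
  -- The climb stops once the value `g A` is reached, possibly at a set other than `A`.
  ... | yes A≤B = [] , [] , [] , subst (g A ≤_) (cong g (sym (∪-identityʳ B))) A≤B , [-]
  ... | no  A≰B with step B⊆A (≰⇒> A≰B)
  ... | e , e∈A , e∉B , up
    with ascend step {B ∪ ⁅ e ⁆} Be⊆A (rec (p⊆p∪q ⁅ e ⁆ , e , e∈Be , e∉B))
    where
    e∈Be : e ∈ B ∪ ⁅ e ⁆
    e∈Be = q⊆p∪q B ⁅ e ⁆ (x∈⁅x⁆ e)
    Be⊆A : B ∪ ⁅ e ⁆ ⊆ A
    Be⊆A x∈ with x∈p∪q⁻ B ⁅ e ⁆ x∈
    ... | inj₁ x∈B = B⊆A x∈B
    ... | inj₂ x∈e = subst (_∈ A) (sym (x∈⁅y⁆⇒x≡y e x∈e)) e∈A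
  ... | es , uniq , fresh , top , linked =
    e ∷ es ,
    All.map (λ {f} f∉ e≡f → f∉ (q⊆p∪q B ⁅ e ⁆ (subst (_∈ ⁅ e ⁆) e≡f (x∈⁅x⁆ e)))) fresh ∷ uniq ,
    e∉B ∷ All.map (λ f∉ f∈B → f∉ (p⊆p∪q ⁅ e ⁆ f∈B)) fresh ,
    subst (λ Y → g A ≤ g Y) (∪-assoc B ⁅ e ⁆ (toSubset es)) top ,
    subst (λ ws → Linked _≤_ (g B ∷ ws)) (sym (widths-∷ B e es)) (up ∷ linked)

  ≤maxOverSubsets : ∀ B → g B ≤ maxOverSubsets g
  ≤maxOverSubsets B = All.lookup (xs≤max 0 (map g (subsets n))) (∈-map⁺ g (∈-subsets B))

  maxOverSubsets-attained : ∃[ A ] maxOverSubsets g ≤ g A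
  maxOverSubsets-attained with argmax-sel (λ k → k) 0 (map g (subsets n))
  -- If the maximum is the starting value 0, every subset reaches it.
  ... | inj₁ eq = ⊥ , subst (_≤ g ⊥) (sym eq) z≤n
  ... | inj₂ m∈ with ∈-map⁻ g m∈
  ... | A , _ , eq = A , ≤-reflexive eq

-- Monotone paths for a sum of two distances.

module _ {n} {D₁ D₂ : SetSystem n} (dm₁ : IsDeltaMatroid D₁) (dm₂ : IsDeltaMatroid D₂) where

  private
    open IsDeltaMatroid dm₁ using () renaming (proper to p₁)
    open IsDeltaMatroid dm₂ using () renaming (proper to p₂)
    f : Subset n → ℕ
    f B = dist D₁ B + dist D₂ B

  -- One of the two distances must be smaller at `A` than at `B`. The element that lowers it by at
  -- least one raises the other by at most one, so the sum does not grow.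
  dist-sum-step : {A B : Subset n} → B ⊆ A → f A < f B →
    ∃[ e ] (e ∈ A × e ∉ B × f (B ∪ ⁅ e ⁆) ≤ f B)
  dist-sum-step {A} {B} B⊆A fA<fB with dist D₁ A <? dist D₁ B | dist D₂ A <? dist D₂ B
  ... | yes lt | _ =
    let e , e∈A , e∉B , down = approach dm₁ B⊆A lt
    in e , e∈A , e∉B , s≤s⁻¹ (≤-trans (+-mono-≤ down (dist-∪≤ D₂ p₂ B e∉B))
                                     (≤-reflexive (+-suc (dist D₁ B) (dist D₂ B))))
  ... | no _ | yes lt =
    let e , e∈A , e∉B , down = approach dm₂ B⊆A lt
    in e , e∈A , e∉B , s≤s⁻¹ (≤-trans (≤-reflexive (sym (+-suc (dist D₁ (B ∪ ⁅ e ⁆)) _)))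
                                     (+-mono-≤ (dist-∪≤ D₁ p₁ B e∉B) down))
  ... | no ge₁ | no ge₂ = contradiction fA<fB (≤⇒≯ (+-mono-≤ (≮⇒≥ ge₁) (≮⇒≥ ge₂)))

  monotone-path : (g : Subset n → ℕ) → (∀ B → g B ≡ n ∸ f B) →
    Σ[ A ∈ Subset n ] Σ[ es ∈ List (Fin n) ]
      (es IsOrderingOf A × g A ≡ maxOverSubsets g ×
       Linked _≤_ (g ⊥ ∷ map (λ p → g (toSubset p)) (drop 1 (inits es))))
  monotone-path g g≡ =
    let A , A-max = maxOverSubsets-attained g
        es , uniq , _ , top , linked = ascend g step {⊥} (λ x∈⊥ → contradiction x∈⊥ ∉⊥)
                                         (⊃-wellFounded ⊥)
    -- The set returned is the end of the climb rather than the maximiser aimed at; its value is at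
    -- least as large, hence maximal.
    in toSubset es , es , (uniq , refl) ,
       ≤-antisym (≤maxOverSubsets g (toSubset es))
         (≤-trans A-max (subst (λ Y → g A ≤ g Y) (∪-identityˡ (toSubset es)) top)) ,
       subst (λ ws → Linked _≤_ (g ⊥ ∷ ws))
         (map-cong (λ p → cong g (∪-identityˡ (toSubset p))) (drop 1 (inits es))) linked
    where
    step : ∀ {A B} → B ⊆ A → g B < g A → ∃[ e ] (e ∈ A × e ∉ B × g B ≤ g (B ∪ ⁅ e ⁆))
    step {A} {B} B⊆A gB<gA =
      -- Truncated subtraction is only weakly antitone, so `f A < f B` is obtained by
      -- contraposition.
      let e , e∈A , e∉B , fBe≤fB = dist-sum-step B⊆A (≰⇒> λ fB≤fA → <⇒≱ gB<gA
            (subst₂ _≤_ (sym (g≡ A)) (sym (g≡ B)) (∸-monoʳ-≤ n fB≤fA)))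
      in e , e∈A , e∉B , subst₂ _≤_ (sym (g≡ B)) (sym (g≡ (B ∪ ⁅ e ⁆))) (∸-monoʳ-≤ n fBe≤fB)

-- Extreme cardinalities under the two words as distances from `B`.

-- A final loop complementation on ∁ B leaves the minimum unchanged and completes the one on B to
-- a loop complementation on E; this makes the set system on the right independent of B.
rmin-dual-*× : (D : SetSystem n) (B : Subset n) →
  rmin (twist (D ^ *× ∣ B) ⊤) ≡ dist (loopComp (twist D ⊤) ⊤) B
rmin-dual-*× D B =
  trans (sym (rmin-loopComp (twist (loopComp P B) ⊤) (∁ B))) (rmin-cong λ X → sym (identity X))
  where
  P = twist D B
  Q = twist P (∁ B)
  open ≡-Reasoning
  identity : twist (loopComp (twist D ⊤) ⊤) B ≐ loopComp (twist (loopComp P B) ⊤) (∁ B)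
  identity X = begin
    twist (loopComp (twist D ⊤) ⊤) B X
      -- The twist and the loop complementation on the ground set are both split along `B` and
      -- `∁ B`. Operations on disjoint sets commute, which brings the two twists together to form a
      -- twist by the ground set.
      ≡⟨ twist-cong B (loopComp-cong ⊤ split) X ⟩
    twist (loopComp Q ⊤) B X
      ≡⟨ twist-cong B (loopComp-∁ Q B) X ⟨
    twist (loopComp (loopComp Q B) (∁ B)) B X
      ≡⟨ twist-loopComp (loopComp Q B) B (∁ B) x∈∁p⇒x∉p X ⟩
    loopComp (twist (loopComp Q B) B) (∁ B) X
      ≡⟨ loopComp-cong (∁ B) (twist-cong B (twist-loopComp P (∁ B) B x∈p⇒x∉∁p)) X ⟨
    loopComp (twist (twist (loopComp P B) (∁ B)) B) (∁ B) X
      ≡⟨ loopComp-cong (∁ B) merge X ⟩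
    loopComp (twist (loopComp P B) ⊤) (∁ B) X ∎
    where
    split : twist D ⊤ ≐ Q
    split Y = sym (trans (twist-twist D B (∁ B) Y) (cong (λ C → twist D C Y) (X△∁X≡⊤ B)))
    merge : twist (twist (loopComp P B) (∁ B)) B ≐ twist (loopComp P B) ⊤
    merge Y = trans (twist-twist (loopComp P B) (∁ B) B Y)
      (cong (λ C → twist (loopComp P B) C Y) (trans (△-comm (∁ B) B) (X△∁X≡⊤ B)))

-- Loop complementation on `∁ B` keeps the minimum, commutes with the twist by `B`, and completes
-- the loop complementation to the whole ground set.
rmin-×* : (D : SetSystem n) (B : Subset n) → rmin (D ^ ×* ∣ B) ≡ dist (loopComp D ⊤) B
rmin-×* D B = trans (sym (rmin-loopComp (twist (loopComp D B) B) (∁ B))) (rmin-cong λ X →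
  trans (sym (twist-loopComp (loopComp D B) B (∁ B) x∈∁p⇒x∉p X))
        (twist-cong B (loopComp-∁ D B) X))

-- The two twists combine to one by `∁ B`. It commutes with the loop complementation on `B`, which
-- then comes last and does not affect the minimum.
rmin-dual-×* : (D : SetSystem n) (B : Subset n) →
  rmin (twist (D ^ ×* ∣ B) ⊤) ≡ dist (twist D ⊤) B
rmin-dual-×* D B =
  trans (rmin-cong identity) (trans (rmin-loopComp (twist D (∁ B)) B) (rmin-cong dual))
  where
  identity : twist (twist (loopComp D B) B) ⊤ ≐ loopComp (twist D (∁ B)) B
  identity X = trans (twist-twist (loopComp D B) B ⊤ X)
    (trans (cong (λ C → twist (loopComp D B) C X) (△-⊤ B))
           (twist-loopComp D (∁ B) B x∈p⇒x∉∁p X))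
  dual : twist D (∁ B) ≐ twist (twist D ⊤) B
  dual X = sym (trans (twist-twist D ⊤ B X)
    (cong (λ C → twist D C X) (trans (△-comm ⊤ B) (△-⊤ B))))

^-⊥ : (D : SetSystem n) (σ : Word) → D ^ σ ∣ ⊥ ≐ D
^-⊥ D *× X = trans (loopComp-⊥ (twist D ⊥) X) (twist-⊥ D X)
^-⊥ D ×* X = trans (twist-⊥ (loopComp D ⊥) X) (loopComp-⊥ D X)

corollary4p7 : (n : ℕ) (D : SetSystem n) → IsDeltaMatroid D → VfSafe D → (σ : Word) →
    Σ[ A ∈ Subset n ] Σ[ es ∈ List (Fin n) ]
    (es IsOrderingOf A
    × ω (D ^ σ ∣ A) ≡ maxOverSubsets (λ B → ω (D ^ σ ∣ B))
    × Linked _≤_ (ω D ∷ map (λ p → ω (D ^ σ ∣ toSubset p)) (drop 1 (inits es))))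
corollary4p7 n D dm vf σ =
  let A , es , ordering , maximal , linked = path σ
  in A , es , ordering , maximal ,
     -- The path starts at the word applied to the empty set, which agrees pointwise with `D`.
     subst (λ w → Linked _≤_ (w ∷ map (λ p → ω (D ^ σ ∣ toSubset p)) (drop 1 (inits es))))
           (ω-cong (^-⊥ D σ)) linked
  where
  path : (σ : Word) → Σ[ A ∈ Subset n ] Σ[ es ∈ List (Fin n) ]
    (es IsOrderingOf A
    × ω (D ^ σ ∣ A) ≡ maxOverSubsets (λ B → ω (D ^ σ ∣ B))
    × Linked _≤_ (ω (D ^ σ ∣ ⊥) ∷ map (λ p → ω (D ^ σ ∣ toSubset p)) (drop 1 (inits es))))
  -- The two delta-matroids are `loopComp (twist D ⊤) ⊤`, for the largest size, and `D` itself, for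
  -- the smallest.
  path *× = monotone-path (vf (twistBy ⊤ ∷ loopCompBy ⊤ ∷ [])) dm
    (λ B → ω (D ^ *× ∣ B)) λ B → trans (ω-rmin (D ^ *× ∣ B))
      (cong₂ (λ a b → n ∸ (a + b)) (rmin-dual-*× D B) (rmin-loopComp (twist D B) B))
  -- Here they are `twist D ⊤` and `loopComp D ⊤`, both delta-matroids by vf-safety.
  path ×* = monotone-path (vf (twistBy ⊤ ∷ [])) (vf (loopCompBy ⊤ ∷ []))
    (λ B → ω (D ^ ×* ∣ B)) λ B → trans (ω-rmin (D ^ ×* ∣ B))
      (cong₂ (λ a b → n ∸ (a + b)) (rmin-dual-×* D B) (rmin-×* D B))
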